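{- Let $X$ be an Alexandroff space. Then the regular closed algebra $\mathrm{RC}(X)$ with the contact relation $A\mathrel{\mathsf{C}}B \iff A\cap B\neq\emptyset$ satisfies (C4$^c$): for every $A\in\mathrm{RC}(X)$ and every family $\mathcal{S}\subseteq\mathrm{RC}(X)$, if $A\mathrel{\mathsf{C}}\bigvee\mathcal{S}$, then there is $S\in\mathcal{S}$ such that $A\mathrel{\mathsf{C}}S$.
   Context: An Alexandroff space is a topological space in which the intersection of any family of open sets is open. For a topological space $X$, $\mathrm{RC}(X)$ is the complete Boolean algebra of regular closed subsets of $X$ (sets $A\subseteq X$ with $A=\mathrm{Cl}\,\mathrm{Int}\,A$, where $\mathrm{Cl}$ and $\mathrm{Int}$ are closure and interior), with operations $A\cdot B=\mathrm{Cl}\,\mathrm{Int}(A\cap B)$, $A+B=A\cup B$, $-A=\mathrm{Cl}(X\setminus A)$, and $\bigvee\mathcal{S}=\mathrm{Cl}\bigcup\mathcal{S}$. -}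

module Defs where

open import Data.Empty using (⊥)
open import Data.Product using (∃-syntax; _×_; _,_; proj₁)
open import Data.Unit using (⊤)
open import Level using (Level; Lift; suc; _⊔_)
open import Relation.Unary
  using (Pred; _∈_; _⊆_; _≐_; _∩_; ∁; ⋃; ⋂; Satisfiable)

private
  variable
    ℓ o p q s : Level

-- Subsets of the carrier are predicates, compared by extensional equality _≐_;
-- since Agda predicates with the same elements need not be equal, a topology is
-- required to respect _≐_.  Families of open sets are indexed by an arbitrary
-- I : Set ℓ; classically the powerset of Carrier : Set ℓ is itself indexed by
-- Carrier → Bool : Set ℓ, so this covers every family of open sets.
record TopologicalSpace (ℓ o : Level) : Set (suc (ℓ ⊔ o)) where
  field
    Carrier : Set ℓ
    Open    : Pred (Pred Carrier ℓ) o
    Open-≐  : ∀ {V W : Pred Carrier ℓ} → V ≐ W → Open V → Open W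
    Open-∅  : Open (λ _ → Lift ℓ ⊥)
    Open-U  : Open (λ _ → Lift ℓ ⊤)
    Open-∩  : ∀ {V W : Pred Carrier ℓ} → Open V → Open W → Open (V ∩ W)
    Open-⋃  : ∀ {I : Set ℓ} (V : I → Pred Carrier ℓ) →
              (∀ i → Open (V i)) → Open (⋃ I V)

  Closed : Pred (Pred Carrier ℓ) o
  Closed F = Open (∁ F)

Alexandroff : TopologicalSpace ℓ o → Set (suc ℓ ⊔ o)
Alexandroff {ℓ} X =
  ∀ {I : Set ℓ} (V : I → Pred Carrier ℓ) → (∀ i → Open (V i)) → Open (⋂ I V)
  where open TopologicalSpace X

module _ (X : TopologicalSpace ℓ o) where
  open TopologicalSpace X

  -- Interior and closure quantify over all open (closed) sets, so they raise
  -- the universe level; hence they, and regular closed sets below, are defined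
  -- for predicates of any level.
  Int : Pred Carrier p → Pred Carrier (suc ℓ ⊔ o ⊔ p)
  Int A x = ∃[ V ] Open V × V ⊆ A × x ∈ V

  Cl : Pred Carrier p → Pred Carrier (suc ℓ ⊔ o ⊔ p)
  Cl A x = ∀ F → Closed F → A ⊆ F → x ∈ F

  record RC (p : Level) : Set (suc (ℓ ⊔ p) ⊔ o) where
    field
      set     : Pred Carrier p
      regular : set ≐ Cl (Int set)

module _ {X : TopologicalSpace ℓ o} where
  open TopologicalSpace X
  open RC

  private
    Int-mono : {A : Pred Carrier p} {B : Pred Carrier q} →
               A ⊆ B → Int X A ⊆ Int X B
    Int-mono A⊆B (V , oV , V⊆A , x∈V) = V , oV , (λ y∈V → A⊆B (V⊆A y∈V)) , x∈V

    Cl-mono : {A : Pred Carrier p} {B : Pred Carrier q} →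
              A ⊆ B → Cl X A ⊆ Cl X B
    Cl-mono A⊆B x∈ F cF B⊆F = x∈ F cF (λ y∈A → B⊆F (A⊆B y∈A))

  ⋃ᶠ : Pred (RC X p) s → Pred Carrier (suc (ℓ ⊔ p) ⊔ o ⊔ s)
  ⋃ᶠ 𝒮 x = ∃[ S ] S ∈ 𝒮 × x ∈ set S

  ⋁ : Pred (RC X p) s → RC X (suc (ℓ ⊔ p) ⊔ o ⊔ s)
  ⋁ 𝒮 .set = Cl X (⋃ᶠ 𝒮)
  ⋁ 𝒮 .regular = to , from
    where
    member : ⋃ᶠ 𝒮 ⊆ Cl X (Int X (Cl X (⋃ᶠ 𝒮)))
    member (S , S∈𝒮 , x∈S) =
      Cl-mono (Int-mono (λ y∈S F _ ⋃⊆F → ⋃⊆F (S , S∈𝒮 , y∈S)))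
              (proj₁ (regular S) x∈S)

    to : Cl X (⋃ᶠ 𝒮) ⊆ Cl X (Int X (Cl X (⋃ᶠ 𝒮)))
    to x∈ F cF Int⊆F = x∈ F cF (λ y∈⋃ → member y∈⋃ F cF Int⊆F)

    from : Cl X (Int X (Cl X (⋃ᶠ 𝒮))) ⊆ Cl X (⋃ᶠ 𝒮)
    from x∈ F cF ⋃⊆F = x∈ F cF (λ (V , _ , V⊆Cl , y∈V) → V⊆Cl y∈V F cF ⋃⊆F)

  infix 4 _C_
  _C_ : RC X p → RC X q → Set (ℓ ⊔ p ⊔ q)
  A C B = Satisfiable (set A ∩ set B)

{-# OPTIONS --safe #-}
-- In an Alexandroff space a union of closed sets is closed, so the join of 𝒮
-- is its plain union, and a point of A ∩ ⋁ 𝒮 already lies in some S ∈ 𝒮.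
-- Universe levels need care: closedness is only defined for predicates of level
-- ℓ and for families indexed by Set ℓ.  Excluded middle resizes predicates to
-- level ℓ, and families are reindexed by points: a union of open sets by the
-- points of the union, and the intersection of the complements of the members
-- of 𝒮 by the points of ⋃ᶠ 𝒮, with one chosen member through each point.
module Submission where

open import Axiom.ExcludedMiddle using (ExcludedMiddle)
open import Data.Product using (Σ; ∃-syntax; _×_; _,_; proj₁; proj₂)
open import Level using (Level)
open import Relation.Nullary using (¬_; contradiction)
open import Relation.Nullary.Decidable using (True; decidable-stable; toWitness; fromWitness)
open import Relation.Unary using (Pred; _∈_; _∉_; _⊆_; _≐_; ∁; ⋃; ⋂)
open import Defs

private
  variable
    ℓ o p q s : Level

module _ (X : TopologicalSpace ℓ o) where
  open TopologicalSpace X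

  Int-open : {W : Pred Carrier ℓ} → W ⊆ Int X W → Open W
  Int-open {W} W⊆Int = Open-≐ (to , from) (Open-⋃ nbhd λ (_ , y∈W) → proj₁ (proj₂ (W⊆Int y∈W)))
    where
    nbhd : Σ Carrier W → Pred Carrier ℓ
    nbhd (_ , y∈W) = proj₁ (W⊆Int y∈W)

    to : ⋃ _ nbhd ⊆ W
    to ((_ , y∈W) , x∈V) = proj₁ (proj₂ (proj₂ (W⊆Int y∈W))) x∈V

    from : W ⊆ ⋃ _ nbhd
    from x∈W = (_ , x∈W) , proj₂ (proj₂ (proj₂ (W⊆Int x∈W)))

module _ (em : ∀ {e} → ExcludedMiddle e) where

  -- `True` lands in the lowest universe, so the record fits at any level `r`.
  record Resize (r : Level) (P : Set p) : Set r where
    constructor squash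
    field
      holds : True (em {P = P})

  resize : ∀ {r} {P : Set p} → P → Resize r P
  resize x = squash (fromWitness x)

  unresize : ∀ {r} {P : Set p} → Resize r P → P
  unresize (squash t) = toWitness t

  ⌊_⌋ : ∀ {a r} {A : Set a} → Pred A p → Pred A r
  ⌊ P ⌋ x = Resize _ (P x)

  module _ (X : TopologicalSpace ℓ o) where
    open TopologicalSpace X

    separate : {B : Pred Carrier q} {y : Carrier} → y ∉ Cl X B →
               ∃[ F ] Closed F × B ⊆ F × y ∉ F
    separate {B = B} {y} y∉Cl =
      decidable-stable em λ (¬sep : ¬ (∃[ F ] Closed F × B ⊆ F × y ∉ F)) →
        y∉Cl λ F cF B⊆F → decidable-stable em λ y∉F → ¬sep (F , cF , B⊆F , y∉F)

    -- A closed set separating a point from `B` has an open complement, which is the neighbourhood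
    -- that `Int-open` asks for.
    Cl-closed : {A : Pred Carrier p} {B : Pred Carrier q} →
                A ≐ Cl X B → Closed ⌊ A ⌋
    Cl-closed {A = A} (A⊆Cl , Cl⊆A) = Int-open X nbhd
      where
      nbhd : ∁ ⌊ A ⌋ ⊆ Int X (∁ ⌊ A ⌋)
      nbhd y∉A with separate (λ y∈Cl → y∉A (resize (Cl⊆A y∈Cl)))
      ... | F , cF , B⊆F , y∉F =
        ∁ F , cF , (λ w∉F w∈A → w∉F (A⊆Cl (unresize w∈A) F cF B⊆F)) , y∉F

    ⋃ᶠ-closed : Alexandroff X → (𝒮 : Pred (RC X p) s) → Closed ⌊ ⋃ᶠ 𝒮 ⌋
    ⋃ᶠ-closed alex 𝒮 = Open-≐ (to , from) (alex V λ i → Cl-closed (RC.regular (through i)))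
      where
      through : Σ Carrier ⌊ ⋃ᶠ 𝒮 ⌋ → RC X _
      through (_ , z∈⋃) = proj₁ (unresize z∈⋃)

      V : Σ Carrier ⌊ ⋃ᶠ 𝒮 ⌋ → Pred Carrier ℓ
      V i = ∁ ⌊ RC.set (through i) ⌋

      to : ⋂ _ V ⊆ ∁ ⌊ ⋃ᶠ 𝒮 ⌋
      -- The point `w` is its own index: the member chosen through `w` contains `w`.
      to w∈⋂ w∈⋃ =
        contradiction (resize (proj₂ (proj₂ (unresize w∈⋃)))) (w∈⋂ (_ , w∈⋃))

      from : ∁ ⌊ ⋃ᶠ 𝒮 ⌋ ⊆ ⋂ _ V
      from w∉⋃ i@(_ , z∈⋃) w∈S =
        w∉⋃ (resize (through i , proj₁ (proj₂ (unresize z∈⋃)) , unresize w∈S))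

proposition4p3 :
    (∀ {e} → ExcludedMiddle e) →
    ∀ {ℓ o p s : Level} (X : TopologicalSpace ℓ o) → Alexandroff X →
    (A : RC X p) (𝒮 : Pred (RC X p) s) →
    A C ⋁ 𝒮 → ∃[ S ] S ∈ 𝒮 × A C S
proposition4p3 em X alex A 𝒮 (x , x∈A , x∈⋁)
  -- The resized union is one of the closed sets over which the closure ranges.
  with unresize em (x∈⋁ _ (⋃ᶠ-closed em X alex 𝒮) (resize em))
... | S , S∈𝒮 , x∈S = S , S∈𝒮 , x , x∈A , x∈S
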